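{- Let $G$ be a $2$-connected graph. Then for every integer $k\ge 1$ there is a protocol $\Pi_k$ solving the multiparty equality problem on $G$ with $k$-bit inputs in the local broadcast model, with total cost at most $(k/2+o(k))\cdot \mathsf{tvc}(G)$ as $k\to\infty$. In particular the per-bit cost of this family of protocols is at most $\tfrac12\,\mathsf{tvc}(G)$, and $\mathrm{opt}(G)\le \tfrac12\,\mathsf{tvc}(G)$.
   Context: All graphs are finite, simple and connected. Multiparty equality in the local broadcast model: every vertex of a graph $G$ receives a $k$-bit input string. Vertices communicate by broadcasting messages; a message broadcast by a vertex $v$ is received by all neighbors of $v$. Protocols are deterministic and static: which vertices send messages and the lengths of their messages depend only on $G$ and $k$, while the content of a message may depend on the sender's input and on messages it has received. After communication each vertex accepts or rejects; the protocol solves the problem if, whenever all inputs are equal, every vertex accepts, and whenever two inputs differ, at least one vertex rejects. The total cost of a protocol is the sum over all broadcasts of the number of bits broadcast (each broadcast counted once regardless of the number of receivers). $\mathrm{opt}(G,k)$ is the minimum total cost of a protocol solving the problem on $G$ with $k$-bit inputs, and $\mathrm{opt}(G)=\lim_{k\to\infty}\mathrm{opt}(G,k)/k$ (the per-bit complexity; this limit exists). For a family of protocols $(\Pi_k)_k$, its per-bit cost is $\lim_{k\to\infty}\mathrm{cost}(\Pi_k)/k$. A total vertex cover of $G$ is a set $S\subseteq V(G)$ that is a vertex cover (every edge has an endpoint in $S$) and a total dominating set (every vertex of $G$ has a neighbor in $S$); $\mathsf{tvc}(G)$ is the minimum size of a total vertex cover. -}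

module Defs where

open import Data.Nat using (ℕ; _≤_; _+_; _*_)
open import Data.Bool using (Bool; true; false)
open import Data.Fin using (Fin)
open import Data.Fin.Subset using (Subset; _∈_; ∣_∣)
open import Data.Vec using (Vec; toList)
open import Data.List using (List; []; _∷_; _++_; [_]; map; filterᵇ)
open import Data.Nat.ListAction using (sum)
open import Data.Product using (_×_; _,_; proj₁; proj₂; ∃; Σ)
open import Data.Sum using (_⊎_)
open import Data.Unit using (⊤)
open import Relation.Binary.PropositionalEquality using (_≡_; _≢_)

record Graph (n : ℕ) : Set where
  field
    adj     : Fin n → Fin n → Bool
    adj-sym : ∀ u v → adj u v ≡ adj v u
    adj-irr : ∀ v → adj v v ≡ false
open Graph public

data Reach {n : ℕ} (G : Graph n) (ok : Fin n → Set) : Fin n → Fin n → Set where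
  here : ∀ {u} → Reach G ok u u
  step : ∀ {u w v} → adj G u w ≡ true → ok w → Reach G ok w v → Reach G ok u v

Connected : ∀ {n} → Graph n → Set
Connected G = ∀ u v → Reach G (λ _ → ⊤) u v

TwoConnected : ∀ {n} → Graph n → Set
TwoConnected {n} G =
  (3 ≤ n) × Connected G ×
  (∀ x u v → u ≢ x → v ≢ x → Reach G (λ w → w ≢ x) u v)

IsVertexCover : ∀ {n} → Graph n → Subset n → Set
IsVertexCover G S = ∀ u v → adj G u v ≡ true → (u ∈ S) ⊎ (v ∈ S)

IsTotalDominating : ∀ {n} → Graph n → Subset n → Set
IsTotalDominating G S = ∀ v → ∃ λ u → (adj G v u ≡ true) × (u ∈ S)

IsTotalVertexCover : ∀ {n} → Graph n → Subset n → Set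
IsTotalVertexCover G S = IsVertexCover G S × IsTotalDominating G S

IsTvc : ∀ {n} → Graph n → ℕ → Set
IsTvc {n} G t =
  (Σ (Subset n) λ S → IsTotalVertexCover G S × ∣ S ∣ ≡ t) ×
  (∀ (T : Subset n) → IsTotalVertexCover G T → t ≤ ∣ T ∣)

-- Deterministic static protocols in the local broadcast model.
-- A protocol is a fixed sequence of broadcasts.  Each broadcast has a
-- fixed sender and a fixed length (depending only on G and k); its content
-- is a function of the sender's k-bit input and of the list of messages
-- the sender has received so far (in order).

Input : ℕ → Set
Input k = Vec Bool k

Received : Set
Received = List (List Bool)

record Broadcast (n k : ℕ) : Set where
  field
    sender  : Fin n
    len     : ℕ
    content : Input k → Received → Vec Bool len
open Broadcast public

record Protocol (n k : ℕ) : Set where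
  field
    broadcasts : List (Broadcast n k)
    accept     : Fin n → Input k → Received → Bool
open Protocol public

Transcript : ℕ → Set
Transcript n = List (Fin n × List Bool)

view : ∀ {n} → Graph n → Fin n → Transcript n → Received
view G v tr = map proj₂ (filterᵇ (λ p → adj G (proj₁ p) v) tr)

run : ∀ {n k} → Graph n → (Fin n → Input k) → List (Broadcast n k) →
      Transcript n → Transcript n
run G x [] tr = tr
run G x (b ∷ bs) tr =
  run G x bs (tr ++ [ (sender b , toList (content b (x (sender b)) (view G (sender b) tr))) ])

Accepts : ∀ {n k} → Graph n → Protocol n k → (Fin n → Input k) → Fin n → Set
Accepts G P x v = accept P v (x v) (view G v (run G x (broadcasts P) [])) ≡ true

Rejects : ∀ {n k} → Graph n → Protocol n k → (Fin n → Input k) → Fin n → Set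
Rejects G P x v = accept P v (x v) (view G v (run G x (broadcasts P) [])) ≡ false

SolvesEquality : ∀ {n k} → Graph n → Protocol n k → Set
SolvesEquality {n} {k} G P =
  (∀ (x : Fin n → Input k) → (∀ u v → x u ≡ x v) → ∀ v → Accepts G P x v) ×
  (∀ (x : Fin n → Input k) → (∃ λ u → ∃ λ v → x u ≢ x v) → ∃ λ w → Rejects G P x w)

cost : ∀ {n k} → Protocol n k → ℕ
cost P = sum (map len (broadcasts P))

{-# OPTIONS --safe #-}
module Submission where

-- Cut every input x into two vectors a, d of natural numbers, so that x becomes the line
-- c ↦ a + c d.  Number the vertices by an st-numbering c whose ends s, t are adjacent members of
-- a total vertex cover S; every u ∈ S broadcasts the point of its own line at c u, which takes
-- k/2 + o(k) bits, together with |d|², which takes o(k) bits.  If nobody rejects then, across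
-- every edge, two lines meet at the number of an endpoint in S, and all directions lie on one
-- sphere.  Projected onto the direction of s, a slope is at most |d|², with equality only for
-- that direction; so the deviation of the projected line of v from that of s, taken at c v, can
-- only decrease as c increases along edges.  It vanishes at s and at t (which share their line,
-- as they meet at two numbers), hence everywhere, which forces all lines to coincide.

open import Defs
import Algebra.Properties.Semiring.Sum
open import Data.Bool using (Bool; true; false)
open import Data.Bool.Properties using () renaming (_≟_ to _≟ᵇ_)
open import Data.Fin using (Fin; zero; suc; toℕ; combine; funToFin; finToFun; _↑ˡ_; _↑ʳ_; splitAt)
open import Data.Fin.Properties
  using (_≟_; any?; toℕ<n; toℕ-injective; finToFun-funToFin; combine-surjective; join-splitAt)
open import Data.Fin.Subset using (Subset; ∣_∣; inside; outside) renaming (_∈_ to _∈ₛ_)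
open import Data.List
  using (List; []; _∷_; _++_; [_]; length; reverse; map; filterᵇ; tabulate; allFin; cartesianProduct)
import Data.List as List
open import Data.List.Membership.DecPropositional using (_∈?_)
open import Data.List.Membership.Propositional using (_∈_; _∉_)
open import Data.List.Membership.Propositional.Properties
  using (∈-++⁺ʳ; ∈-++⁻; ∈-map⁺; ∈-allFin; ∈-cartesianProduct⁺)
open import Data.List.Properties
  using (≡-dec; ∷-injectiveˡ; ∷-injectiveʳ; ++-identityʳ; ++-assoc; map-∘; map-++; map-tabulate; length-map)
open import Data.List.Relation.Binary.Permutation.Propositional using (_↭_; ↭-sym; ↭-trans; ↭⇒↭ₛ)
import Data.List.Relation.Binary.Permutation.Propositional.Properties as ↭
open import Data.List.Relation.Binary.Permutation.Setoid.Properties using (Unique-resp-↭)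
open import Data.List.Relation.Binary.Sublist.Propositional
  using (_⊆_; _∷_; _∷ʳ_; minimum; ⊆-refl; ⊆-trans; to∈; from∈)
open import Data.List.Relation.Binary.Sublist.Propositional.Properties
  using (++⁺; ++⁺ˡ; ++⁺ʳ) renaming (reverse⁺ to ⊆-reverse)
open import Data.List.Relation.Unary.All using (All; []; _∷_)
import Data.List.Relation.Unary.All as All
open import Data.List.Relation.Unary.All.Properties using (¬Any⇒All¬)
open import Data.List.Relation.Unary.AllPairs using ([]; _∷_)
open import Data.List.Relation.Unary.Any using (here; there; index)
open import Data.List.Relation.Unary.Any.Properties using (lookup-index; reverse⁺)
open import Data.List.Relation.Unary.Unique.Propositional using (Unique)
open import Data.List.Relation.Unary.Unique.Propositional.Properties
  using (Unique[x∷xs]⇒x∉xs) renaming (++⁺ to Unique-++)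
open import Data.Nat
  using (ℕ; zero; suc; _+_; _*_; _^_; _/_; _%_; _≤_; _<_; _≡ᵇ_; _<?_; z≤n; s≤s; z<s; s<s; ∣_-_∣)
open import Data.Nat.DivMod using (m≡m%n+[m/n]*n; m%n<n; m<n*o⇒m/o<n)
open import Data.Nat.ListAction using (sum)
open import Data.Nat.ListAction.Properties using (sum-++)
open import Data.Nat.Properties hiding (_≟_)
open import Data.Nat.Tactic.RingSolver using (solve-∀)
open import Data.Product using (_×_; _,_; ∃; ∃₂; proj₁; proj₂)
open import Data.Sum using (_⊎_; inj₁; inj₂; map₂; [_,_]′)
open import Data.Unit using (⊤)
open import Data.Vec using (Vec; []; _∷_; lookup; padRight; toList; here; there)
open import Data.Vec.Properties
  using (∷-injective; cast-is-id; toList-injective; tabulate∘lookup; tabulate-cong)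
open import Function using (_∘_; id)
open import Relation.Binary.Definitions using (tri<; tri≈; tri>)
open import Relation.Binary.PropositionalEquality
  using (_≡_; _≢_; refl; sym; trans; cong; cong₂; setoid; module ≡-Reasoning)
open import Relation.Nullary using (Dec; does; yes; no; contradiction)
open import Relation.Nullary.Decidable using (dec-true)

open Algebra.Properties.Semiring.Sum +-*-semiring
  using (sum-cong-≗; ∑-distrib-+; *-distribˡ-sum) renaming (sum to ∑)

-- st-numberings

module _ {a} {A : Set a} where

  -- Encoded as a sublist, so that inserting vertices preserves it by transitivity of `⊆` and
  -- reversing the list swaps its arguments.
  Before : List A → A → A → Set a
  Before l u v = (u ∷ v ∷ []) ⊆ l

  Unique-↭ : ∀ {xs ys : List A} → xs ↭ ys → Unique xs → Unique ys
  Unique-↭ p = Unique-resp-↭ (setoid A) (↭⇒↭ₛ p)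

  Before-split : ∀ {l u v} → Before l u v → ∃₂ λ as bs → l ≡ as ++ u ∷ bs × v ∈ bs
  Before-split (y ∷ʳ τ) with Before-split τ
  ... | as , bs , refl , v∈bs = y ∷ as , bs , refl , v∈bs
  Before-split (refl ∷ τ) = [] , _ , refl , to∈ τ

  Before-total : ∀ {l u v} → u ∈ l → v ∈ l → u ≢ v → Before l u v ⊎ Before l v u
  Before-total (here refl) (here refl) u≢v = contradiction refl u≢v
  Before-total (here refl) (there q)   u≢v = inj₁ (refl ∷ from∈ q)
  Before-total (there p)   (here refl) u≢v = inj₂ (refl ∷ from∈ p)
  Before-total (there p)   (there q)   u≢v =
    [ (λ τ → inj₁ (_ ∷ʳ τ)) , (λ τ → inj₂ (_ ∷ʳ τ)) ]′ (Before-total p q u≢v)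

  Before⇒index< : ∀ {l u v} → Unique l → Before l u v →
                  (p : u ∈ l) (q : v ∈ l) → toℕ (index p) < toℕ (index q)
  Before⇒index< l! (_ ∷ʳ τ) (here refl) _ =
    contradiction (to∈ (⊆-trans (refl ∷ minimum _) τ)) (Unique[x∷xs]⇒x∉xs l!)
  Before⇒index< l! (_ ∷ʳ τ) (there _) (here refl) =
    contradiction (to∈ (⊆-trans (_ ∷ʳ ⊆-refl) τ)) (Unique[x∷xs]⇒x∉xs l!)
  Before⇒index< (_ ∷ l!) (_ ∷ʳ τ) (there p) (there q) = s<s (Before⇒index< l! τ p q)
  Before⇒index< l! (refl ∷ τ) (here refl) (here refl) = contradiction (to∈ τ) (Unique[x∷xs]⇒x∉xs l!)
  Before⇒index< l! (refl ∷ τ) (here refl) (there _)   = z<s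
  Before⇒index< l! (refl ∷ τ) (there p) _ = contradiction p (Unique[x∷xs]⇒x∉xs l!)

-- Iterating the two local conditions gives a descending chain of neighbours from any vertex to `s`
-- and an ascending one to `t`; `bound` makes the ascent terminate and later limits message lengths.
record STNumbering {n} (G : Graph n) (s t : Fin n) : Set where
  field
    c         : Fin n → ℕ
    bound     : ℕ
    c<bound   : ∀ v → c v < bound
    injective : ∀ {u v} → c u ≡ c v → u ≡ v
    lower     : ∀ v → v ≡ s ⊎ ∃ λ u → adj G u v ≡ true × c u < c v
    higher    : ∀ v → v ≡ t ⊎ ∃ λ w → adj G v w ≡ true × c v < c w

module _ {n} (G : Graph n) where

  private
    _∈ᵇ_ = _∈?_ (_≟_ {n})

  Adjacent : Fin n → Fin n → Set
  Adjacent u v = adj G u v ≡ true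

  Adjacent-sym : ∀ {u v} → Adjacent u v → Adjacent v u
  Adjacent-sym {u} {v} e = trans (adj-sym G v u) e

  Adjacent⇒≢ : ∀ {u v} → Adjacent u v → u ≢ v
  Adjacent⇒≢ {u} e refl with trans (sym e) (adj-irr G u)
  ... | ()

  -- The list holds the internal vertices only.
  data Path : Fin n → List (Fin n) → Fin n → Set where
    edge : ∀ {x z} → Adjacent x z → Path x [] z
    _∷_ : ∀ {x y ys z} → Adjacent x y → Path y ys z → Path x (y ∷ ys) z

  predecessor : ∀ {x ys z v} → Path x ys z → v ∈ ys →
                ∃ λ u → Adjacent u v × Before (x ∷ ys) u v
  predecessor (e ∷ p) (here refl) = _ , e , refl ∷ refl ∷ minimum _
  predecessor (e ∷ p) (there v∈) with predecessor p v∈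
  ... | u , e′ , τ = u , e′ , _ ∷ʳ τ

  successor : ∀ {x ys z v} → Path x ys z → v ∈ ys →
              ∃ λ w → Adjacent v w × Before (ys ++ [ z ]) v w
  successor (e ∷ edge e′)    (here refl) = _ , e′ , refl ∷ refl ∷ minimum _
  successor (e ∷ (e′ ∷ p))  (here refl) = _ , e′ , refl ∷ refl ∷ minimum _
  successor (e ∷ p)         (there v∈) with successor p v∈
  ... | w , e′ , τ = w , e′ , _ ∷ʳ τ

  -- An edge from `x` to `y` put in front turns this into an open ear of an ear decomposition;
  -- `end≢x` keeps its two ends apart.
  record Ear (l : List (Fin n)) (x y : Fin n) : Set where
    constructor ear
    field
      {interior} : List (Fin n)
      {end}      : Fin n
      end∈       : end ∈ l
      end≢x      : end ≢ x
      path       : Path y interior end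
      simple     : Unique (y ∷ interior)
      avoids    : All (_∉ l) (y ∷ interior)

  Ear-suffix : ∀ {l x w y} (E : Ear l x w) → y ∈ w ∷ Ear.interior E → Ear l x y
  Ear-suffix E                                 (here refl) = E
  Ear-suffix (ear z∈ z≢ (_ ∷ p) (_ ∷ u) (_ ∷ o)) (there y∈)  = Ear-suffix (ear z∈ z≢ p u o) y∈

  -- Follow the walk to its first vertex in `l`, which differs from `x` because the walk avoids `x`.
  -- When the walk returns to `y`, `Ear-suffix` cuts out the loop.
  Reach⇒Ear : ∀ {l x y z} → Reach G (_≢ x) y z → y ∉ l → z ∈ l → Ear l x y
  Reach⇒Ear here y∉ z∈ = contradiction z∈ y∉
  Reach⇒Ear {l} {x} {y} (step {w = w} e w≢x r) y∉ z∈ with w ∈ᵇ l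
  ... | yes w∈ = ear w∈ w≢x (edge e) ([] ∷ []) (y∉ ∷ [])
  ... | no w∉ with Reach⇒Ear r w∉ z∈
  ...   | E with y ∈ᵇ (w ∷ Ear.interior E)
  ...     | yes y∈ = Ear-suffix E y∈
  ...     | no y∉E = ear (Ear.end∈ E) (Ear.end≢x E) (e ∷ Ear.path E)
                       (¬Any⇒All¬ _ y∉E ∷ Ear.simple E) (y∉ ∷ Ear.avoids E)

  -- Invariant of the ear construction: the vertices reached so far, listed in the order of an
  -- st-numbering among themselves.
  record Bipolar (s t : Fin n) (l : List (Fin n)) : Set where
    field
      unique : Unique l
      s∈     : s ∈ l
      t∈     : t ∈ l
      lower  : ∀ {v} → v ∈ l → v ≡ s ⊎ ∃ λ u → Adjacent u v × Before l u v
      higher : ∀ {v} → v ∈ l → v ≡ t ⊎ ∃ λ w → Adjacent v w × Before l v w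

  edge-Bipolar : ∀ {s t} → Adjacent s t → Bipolar s t (s ∷ t ∷ [])
  edge-Bipolar {s} {t} e = record
    { unique = (Adjacent⇒≢ e ∷ []) ∷ ([] ∷ [])
    ; s∈     = here refl
    ; t∈     = there (here refl)
    ; lower  = λ { (here refl) → inj₁ refl ; (there (here refl)) → inj₂ (_ , e , ⊆-refl) }
    ; higher = λ { (here refl) → inj₂ (_ , e , ⊆-refl) ; (there (here refl)) → inj₁ refl }
    }

  reverse-Bipolar : ∀ {s t l} → Bipolar s t l → Bipolar t s (reverse l)
  reverse-Bipolar {l = l} B = record
    { unique = Unique-↭ (↭-sym (↭.↭-reverse l)) unique
    ; s∈     = reverse⁺ t∈
    ; t∈     = reverse⁺ s∈
    ; lower  = λ v∈ → map₂ (λ (w , e , τ) → w , Adjacent-sym e , ⊆-reverse τ) (higher (un v∈))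
    ; higher = λ v∈ → map₂ (λ (u , e , τ) → u , Adjacent-sym e , ⊆-reverse τ) (lower (un v∈))
    }
    where
    open Bipolar B
    un : ∀ {v} → v ∈ reverse l → v ∈ l
    un = ↭.∈-resp-↭ (↭.↭-reverse l)

  Extension : Fin n → Fin n → List (Fin n) → Fin n → Set
  Extension s t l y = ∃ λ l′ → Bipolar s t l′ × (∀ {v} → v ∈ l → v ∈ l′) × y ∈ l′

  -- The path goes right after `x`. A new vertex has its earlier neighbour one step back on the path
  -- and its later one a step ahead, finally `z`, which comes after `x`. Old vertices keep their
  -- neighbours, since `l` is a sublist of the new list.
  insert-path : ∀ {s t l x y ys z} → Bipolar s t l → Before l x z → Path x (y ∷ ys) z →
                Unique (y ∷ ys) → All (_∉ l) (y ∷ ys) → Extension s t l y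
  insert-path {s} {t} {l} {x} {y} {ys} {z} B x<z p simple avoids with Before-split x<z
  ... | as , bs , refl , z∈bs = l′ , B′ , l⇒l′ , ↭.∈-resp-↭ (↭-sym l′↭) (here refl)
    where
    open Bipolar B
    zs = y ∷ ys
    l′ = as ++ x ∷ zs ++ bs
    l′↭ : l′ ↭ zs ++ as ++ x ∷ bs
    l′↭ = ↭-trans (↭.++⁺ˡ as (↭-sym (↭.shift x zs bs))) (↭.shifts as zs)
    l⊆l′ : l ⊆ l′
    l⊆l′ = ++⁺ (⊆-refl {x = as}) (refl ∷ ++⁺ˡ zs ⊆-refl)
    l⇒l′ : ∀ {v} → v ∈ l → v ∈ l′
    l⇒l′ v∈ = ↭.∈-resp-↭ (↭-sym l′↭) (∈-++⁺ʳ zs v∈)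
    split : ∀ {v} → v ∈ l′ → v ∈ zs ⊎ v ∈ l
    split v∈ = ∈-++⁻ zs (↭.∈-resp-↭ l′↭ v∈)
    x∷zs⊆ : x ∷ zs ⊆ l′
    x∷zs⊆ = ++⁺ˡ as (refl ∷ ++⁺ʳ bs ⊆-refl)
    zs∷z⊆ : zs ++ [ z ] ⊆ l′
    zs∷z⊆ = ++⁺ˡ as (x ∷ʳ ++⁺ (⊆-refl {x = zs}) (from∈ z∈bs))
    B′ : Bipolar s t l′
    B′ = record
      { unique = Unique-↭ (↭-sym l′↭)
                   (Unique-++ simple unique (λ (v∈zs , v∈l) → All.lookup avoids v∈zs v∈l))
      ; s∈     = l⇒l′ s∈
      ; t∈     = l⇒l′ t∈
      ; lower  = λ v∈ → [ (λ v∈zs → let u , e , τ = predecessor p v∈zs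
                                    in inj₂ (u , e , ⊆-trans τ x∷zs⊆))
                        , (λ v∈l → map₂ (λ (u , e , τ) → u , e , ⊆-trans τ l⊆l′) (lower v∈l))
                        ]′ (split v∈)
      ; higher = λ v∈ → [ (λ v∈zs → let w , e , τ = successor p v∈zs
                                    in inj₂ (w , e , ⊆-trans τ zs∷z⊆))
                        , (λ v∈l → map₂ (λ (w , e , τ) → w , e , ⊆-trans τ l⊆l′) (higher v∈l))
                        ]′ (split v∈)
      }

  -- If z precedes x, reverse the list: the invariant only swaps the roles of s and t.
  insert-ear : ∀ {s t l x y} → Bipolar s t l → x ∈ l → Adjacent x y → Ear l x y → Extension s t l y
  insert-ear {l = l} B x∈ e (ear z∈ z≢x p simple avoids) with Before-total x∈ z∈ (z≢x ∘ sym)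
  ... | inj₁ x<z = insert-path B x<z (e ∷ p) simple avoids
  ... | inj₂ z<x with insert-path (reverse-Bipolar B) (⊆-reverse z<x) (e ∷ p) simple
                        (All.map (_∘ ↭.∈-resp-↭ (↭.↭-reverse l)) avoids)
  ...   | l′ , B′ , l⇒l′ , y∈ = reverse l′ , reverse-Bipolar B′ , reverse⁺ ∘ l⇒l′ ∘ reverse⁺ , reverse⁺ y∈

  module _ (2-connected : TwoConnected G) {s t : Fin n} (s~t : Adjacent s t) where

    avoid : ∀ {l x y z} → x ∈ l → y ∉ l → z ≢ x → Reach G (_≢ x) y z
    avoid x∈ y∉ = proj₂ (proj₂ 2-connected) _ _ _ (λ { refl → y∉ x∈ })

    extend-step : ∀ {l x y} → Bipolar s t l → x ∈ l → Adjacent x y → Extension s t l y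
    extend-step {l} {x} {y} B x∈ e with y ∈ᵇ l
    ... | yes y∈ = l , B , id , y∈
    -- The ear must return to `l` away from `x`, so the walk aims at `t` if `x` is `s`, and at `s`
    -- otherwise.
    ... | no y∉ with x ≟ s
    ...   | yes refl = insert-ear B x∈ e (Reach⇒Ear (avoid x∈ y∉ (Adjacent⇒≢ s~t ∘ sym)) y∉ (Bipolar.t∈ B))
    ...   | no x≢s = insert-ear B x∈ e (Reach⇒Ear (avoid x∈ y∉ (x≢s ∘ sym)) y∉ (Bipolar.s∈ B))

    extend-along : ∀ {l x y} → Bipolar s t l → x ∈ l → Reach G (λ _ → ⊤) x y → Extension s t l y
    extend-along {l} B x∈ here = l , B , id , x∈
    extend-along B x∈ (step e _ r) with extend-step B x∈ e
    ... | l₁ , B₁ , l⇒l₁ , w∈ with extend-along B₁ w∈ r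
    ...   | l₂ , B₂ , l₁⇒l₂ , y∈ = l₂ , B₂ , l₁⇒l₂ ∘ l⇒l₁ , y∈

    -- Starting from the edge between `s` and `t`, each vertex is reached by a walk from `s`, all of
    -- whose vertices are absorbed in turn.
    cover : (vs : List (Fin n)) → ∃ λ l → Bipolar s t l × (∀ {v} → v ∈ vs → v ∈ l)
    cover [] = _ , edge-Bipolar s~t , λ ()
    cover (v ∷ vs) with cover vs
    ... | l , B , vs⇒l with extend-along B (Bipolar.s∈ B) (proj₁ (proj₂ 2-connected) s v)
    ...   | l′ , B′ , l⇒l′ , v∈ = l′ , B′ , λ { (here refl) → v∈ ; (there w∈) → l⇒l′ (vs⇒l w∈) }

    st-numbering : STNumbering G s t
    st-numbering with cover (allFin n)
    ... | l , B , all∈ = record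
      { c         = toℕ ∘ index ∘ ∈l
      ; bound     = length l
      ; c<bound   = toℕ<n ∘ index ∘ ∈l
      ; injective = λ {u} {v} eq → trans (lookup-index (∈l u))
                      (trans (cong (List.lookup l) (toℕ-injective eq)) (sym (lookup-index (∈l v))))
      ; lower     = λ v → map₂ (λ (u , e , τ) → u , e , Before⇒index< unique τ _ _) (lower (∈l v))
      ; higher    = λ v → map₂ (λ (w , e , τ) → w , e , Before⇒index< unique τ _ _) (higher (∈l v))
      }
      where
      open Bipolar B
      ∈l : ∀ v → v ∈ l
      ∈l v = all∈ (∈-allFin v)

-- Lines over a total vertex cover

⟨_,_⟩ : ∀ {m} → (Fin m → ℕ) → (Fin m → ℕ) → ℕ
⟨ x , y ⟩ = ∑ (λ j → x j * y j)

sum≡0⇒≡0 : ∀ {m} (f : Fin m → ℕ) → ∑ f ≡ 0 → ∀ j → f j ≡ 0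
sum≡0⇒≡0 f eq zero    = m+n≡0⇒m≡0 (f zero) eq
sum≡0⇒≡0 f eq (suc j) = sum≡0⇒≡0 (f ∘ suc) (m+n≡0⇒n≡0 (f zero) eq) j

-- The expansion of the square of `x - y`, arranged without negative terms.
polarization : ∀ x y → 2 * (x * y) + ∣ x - y ∣ * ∣ x - y ∣ ≡ x * x + y * y
polarization x y with ≤-total x y
... | inj₁ x≤y with e , refl ← m≤n⇒∃[o]m+o≡n x≤y rewrite ∣m-m+n∣≡n x e = identity x e
  where
  identity : ∀ x e → 2 * (x * (x + e)) + e * e ≡ x * x + (x + e) * (x + e)
  identity = solve-∀
... | inj₂ y≤x with e , refl ← m≤n⇒∃[o]m+o≡n y≤x rewrite ∣-∣-comm (y + e) y | ∣m-m+n∣≡n y e = identity y e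
  where
  identity : ∀ y e → 2 * ((y + e) * y) + e * e ≡ (y + e) * (y + e) + y * y
  identity = solve-∀

module _ {m} (x y : Fin m → ℕ) where

  private
    gap : ℕ
    gap = ∑ (λ j → ∣ x j - y j ∣ * ∣ x j - y j ∣)

    polarization-sum : 2 * ⟨ x , y ⟩ + gap ≡ ⟨ x , x ⟩ + ⟨ y , y ⟩
    polarization-sum = begin
      2 * ⟨ x , y ⟩ + gap
        ≡⟨ cong (_+ gap) (*-distribˡ-sum 2 (λ j → x j * y j)) ⟩
      ∑ (λ j → 2 * (x j * y j)) + gap
        ≡⟨ ∑-distrib-+ (λ j → 2 * (x j * y j)) _ ⟨
      ∑ (λ j → 2 * (x j * y j) + ∣ x j - y j ∣ * ∣ x j - y j ∣)
        ≡⟨ sum-cong-≗ (λ j → polarization (x j) (y j)) ⟩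
      ∑ (λ j → x j * x j + y j * y j)
        ≡⟨ ∑-distrib-+ (λ j → x j * x j) _ ⟩
      ⟨ x , x ⟩ + ⟨ y , y ⟩ ∎
      where open ≡-Reasoning

    double : ∀ N → 2 * N ≡ N + N
    double = solve-∀

  module _ {N} (x² : ⟨ x , x ⟩ ≡ N) (y² : ⟨ y , y ⟩ ≡ N) where

    private
      bound : 2 * ⟨ x , y ⟩ + gap ≡ 2 * N
      bound = trans polarization-sum (trans (cong₂ _+_ x² y²) (sym (double N)))

    -- Cauchy-Schwarz for vectors of equal norm: the defect `gap` is a sum of squares.
    sphere-≤ : ⟨ x , y ⟩ ≤ N
    sphere-≤ = *-cancelˡ-≤ 2 (m+n≤o⇒m≤o _ (≤-reflexive bound))

    -- Equality case: `gap` vanishes, hence so does each of its squares.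
    sphere-≡ : ⟨ x , y ⟩ ≡ N → ∀ j → x j ≡ y j
    sphere-≡ xy≡N j = ∣m-n∣≡0⇒m≡n (m*m≡0⇒m≡0 (sum≡0⇒≡0 _ gap≡0 j))
      where
      gap≡0 : gap ≡ 0
      gap≡0 = +-cancelˡ-≡ (2 * N) _ _
        (trans (trans (cong (λ z → 2 * z + gap) (sym xy≡N)) bound) (sym (+-identityʳ _)))
      m*m≡0⇒m≡0 : ∀ {m} → m * m ≡ 0 → m ≡ 0
      m*m≡0⇒m≡0 {m} eq with m*n≡0⇒m≡0∨n≡0 m eq
      ... | inj₁ p = p
      ... | inj₂ p = p

slope-unique-< : ∀ {c c′ A A′ B B′} → c < c′ →
                 A + c * B ≡ A′ + c * B′ → A + c′ * B ≡ A′ + c′ * B′ → B ≡ B′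
-- Since `c < c′` means `suc c ≤ c′`, the two numbers differ by `suc e`, a non-zero factor that can
-- be cancelled.
slope-unique-< {c} {A = A} {A′} {B} {B′} c<c′ p q with e , refl ← m≤n⇒∃[o]m+o≡n c<c′ =
  *-cancelˡ-≡ B B′ (suc e) (+-cancelˡ-≡ (A + c * B) _ _
    (trans (shift A c e B) (trans q (trans (sym (shift A′ c e B′)) (cong (_+ suc e * B′) (sym p))))))
  where
  shift : ∀ A c e B → A + c * B + suc e * B ≡ A + suc (c + e) * B
  shift = solve-∀

slope-unique : ∀ {c c′ A A′ B B′} → c ≢ c′ →
               A + c * B ≡ A′ + c * B′ → A + c′ * B ≡ A′ + c′ * B′ → B ≡ B′
slope-unique {c} {c′} c≢c′ p q with <-cmp c c′
... | tri< c<c′ _ _ = slope-unique-< c<c′ p q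
... | tri≈ _ c≡c′ _ = contradiction c≡c′ c≢c′
... | tri> _ _ c′<c = slope-unique-< c′<c q p

-- Rigidity of lines that meet along the edges

module _ {n} {G : Graph n} (connected : Connected G)
         {S : Subset n} (tvc : IsTotalVertexCover G S)
         {s t : Fin n} (s∈S : s ∈ₛ S) (t∈S : t ∈ₛ S) (s~t : Adjacent G s t)
         (numbering : STNumbering G s t) where

  open STNumbering numbering

  private
    c-distinct : ∀ {u v} → Adjacent G u v → c u ≢ c v
    c-distinct e = Adjacent⇒≢ G e ∘ injective

  -- Applied below with the inner products of `a v` and `d v` with `d s` as `A v` and `B v`, and the
  -- squared norm of `d s` as `N`.
  module _ {A B : Fin n → ℕ} {N : ℕ}
           (meet : ∀ {u v} → u ∈ₛ S → Adjacent G u v → A u + c u * B u ≡ A v + c u * B v)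
           (B≤N : ∀ v → B v ≤ N) (Bs≡N : B s ≡ N) (Bt≡N : B t ≡ N) (At≡As : A t ≡ A s) where

    private
      -- The line with origin A v and slope B v, evaluated at its own number.
      height : Fin n → ℕ
      height v = A v + c v * B v

      split : ∀ A c e B → A + (c + e) * B ≡ A + c * B + e * B
      split = solve-∀

      -- The two lines agree at the number of the endpoint in `S`, and the line of the other
      -- endpoint, of slope at most `N`, spans the gap from `c u` to `c v`. So `height` minus `N`
      -- times the number cannot grow upwards.
      rise : ∀ {u v e} → Adjacent G u v → c u + e ≡ c v → height v ≤ height u + e * N
      rise {u} {v} {e} u~v c≡ with proj₁ tvc u v u~v
      ... | inj₁ u∈S = begin
        A v + c v * B v           ≡⟨ cong (λ z → A v + z * B v) c≡ ⟨
        A v + (c u + e) * B v     ≡⟨ split (A v) (c u) e (B v) ⟩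
        A v + c u * B v + e * B v ≡⟨ cong (_+ e * B v) (meet u∈S u~v) ⟨
        height u + e * B v        ≤⟨ +-monoʳ-≤ (height u) (*-monoʳ-≤ e (B≤N v)) ⟩
        height u + e * N          ∎
        where open ≤-Reasoning
      ... | inj₂ v∈S = begin
        A v + c v * B v           ≡⟨ meet v∈S (Adjacent-sym G u~v) ⟩
        A u + c v * B u           ≡⟨ cong (λ z → A u + z * B u) c≡ ⟨
        A u + (c u + e) * B u     ≡⟨ split (A u) (c u) e (B u) ⟩
        height u + e * B u        ≤⟨ +-monoʳ-≤ (height u) (*-monoʳ-≤ e (B≤N u)) ⟩
        height u + e * N          ∎
        where open ≤-Reasoning

      -- Sums `rise` along a descending chain to `s`; `i` is fuel exceeding `c v`.
      upper-bound : ∀ i v → c v < i → height v ≤ A s + c v * N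
      upper-bound (suc i) v cv<i with lower v
      ... | inj₁ refl = ≤-reflexive (cong (λ z → A s + c s * z) Bs≡N)
      ... | inj₂ (u , u~v , cu<cv) with e , c≡ ← m≤n⇒∃[o]m+o≡n (<⇒≤ cu<cv) = begin
        height v                  ≤⟨ rise u~v c≡ ⟩
        height u + e * N          ≤⟨ +-monoˡ-≤ (e * N) (upper-bound i u (<-≤-trans cu<cv (≤-pred cv<i))) ⟩
        A s + c u * N + e * N     ≡⟨ split (A s) (c u) e N ⟨
        A s + (c u + e) * N       ≡⟨ cong (λ z → A s + z * N) c≡ ⟩
        A s + c v * N             ∎
        where open ≤-Reasoning

      -- Sums `rise` along an ascending chain to `t`, whose projected line is that of `s`. The fuel
      -- `i` bounds the remaining ascent and cannot run out, as `c v` stays below `bound`.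
      lower-bound : ∀ i v → bound ≤ i + c v → A s + c v * N ≤ height v
      lower-bound zero v bound≤ = contradiction (c<bound v) (≤⇒≯ bound≤)
      lower-bound (suc i) v bound≤ with higher v
      ... | inj₁ refl = ≤-reflexive (cong₂ (λ x y → x + c t * y) (sym At≡As) (sym Bt≡N))
      ... | inj₂ (w , v~w , cv<cw) with e , c≡ ← m≤n⇒∃[o]m+o≡n (<⇒≤ cv<cw) =
        +-cancelʳ-≤ (e * N) _ _ (begin
          A s + c v * N + e * N     ≡⟨ split (A s) (c v) e N ⟨
          A s + (c v + e) * N       ≡⟨ cong (λ z → A s + z * N) c≡ ⟩
          A s + c w * N             ≤⟨ lower-bound i w bound≤′ ⟩
          height w                  ≤⟨ rise v~w c≡ ⟩
          height v + e * N          ∎)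
        where
        open ≤-Reasoning
        bound≤′ : bound ≤ i + c w
        bound≤′ = ≤-trans bound≤ (≤-trans (≤-reflexive (sym (+-suc i (c v)))) (+-monoʳ-≤ i cv<cw))

      height≡ : ∀ v → height v ≡ A s + c v * N
      height≡ v = ≤-antisym (upper-bound (suc (c v)) v ≤-refl) (lower-bound bound v (m≤m+n bound (c v)))

    -- Total domination gives a neighbour `u` in `S`. The line of `v` meets the line with origin
    -- `A s` and slope `N` at `c u` and at `c v`, so the slopes agree.
    slope-extremal : ∀ v → B v ≡ N
    slope-extremal v with proj₂ tvc v
    ... | u , v~u , u∈S = slope-unique {c u} {c v} (c-distinct (Adjacent-sym G v~u))
      (trans (sym (meet u∈S (Adjacent-sym G v~u))) (height≡ u)) (height≡ v)

  module _ {m} {a d : Fin n → Fin m → ℕ}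
           (norm : ∀ {u v} → u ∈ₛ S → Adjacent G u v → ⟨ d u , d u ⟩ ≡ ⟨ d v , d v ⟩)
           (meet : ∀ {u v} → u ∈ₛ S → Adjacent G u v → ∀ j → a u j + c u * d u j ≡ a v j + c u * d v j)
           where

    private
      N : ℕ
      N = ⟨ d s , d s ⟩

      -- Connectivity spreads the agreement; the vertex cover lets every edge be read from an
      -- endpoint in `S`.
      constant : ∀ {f : Fin n → ℕ} → (∀ {u v} → u ∈ₛ S → Adjacent G u v → f u ≡ f v) → ∀ u v → f u ≡ f v
      constant {f} edge≡ u v = along (connected u v)
        where
        along : ∀ {u v} → Reach G (λ _ → ⊤) u v → f u ≡ f v
        along here = refl
        along (step {u} {w} u~w _ r) with proj₁ tvc u w u~w
        ... | inj₁ u∈S = trans (edge≡ u∈S u~w) (along r)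
        ... | inj₂ w∈S = trans (sym (edge≡ w∈S (Adjacent-sym G u~w))) (along r)

      norm≡N : ∀ v → ⟨ d v , d v ⟩ ≡ N
      norm≡N v = constant norm v s

      -- Both ends lie in `S`, so the lines of `s` and `t` meet at two distinct numbers.
      dt≡ds : ∀ j → d t j ≡ d s j
      dt≡ds j = slope-unique {c t} {c s} (c-distinct (Adjacent-sym G s~t))
        (meet t∈S (Adjacent-sym G s~t) j) (sym (meet s∈S s~t j))

      at≡as : ∀ j → a t j ≡ a s j
      at≡as j = +-cancelʳ-≡ (c t * d t j) _ _
        (trans (meet t∈S (Adjacent-sym G s~t) j) (cong (λ z → a s j + c t * z) (sym (dt≡ds j))))

      inner-line : ∀ x k y → ⟨ (λ j → x j + k * y j) , d s ⟩ ≡ ⟨ x , d s ⟩ + k * ⟨ y , d s ⟩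
      inner-line x k y = begin
        ⟨ (λ j → x j + k * y j) , d s ⟩
          ≡⟨ sum-cong-≗ (λ j → expand (x j) k (y j) (d s j)) ⟩
        ∑ (λ j → x j * d s j + k * (y j * d s j))
          ≡⟨ ∑-distrib-+ (λ j → x j * d s j) _ ⟩
        ⟨ x , d s ⟩ + ∑ (λ j → k * (y j * d s j))
          ≡⟨ cong (⟨ x , d s ⟩ +_) (*-distribˡ-sum k (λ j → y j * d s j)) ⟨
        ⟨ x , d s ⟩ + k * ⟨ y , d s ⟩ ∎
        where
        open ≡-Reasoning
        expand : ∀ x k y z → (x + k * y) * z ≡ x * z + k * (y * z)
        expand = solve-∀

      inner-meet : ∀ {u v} → u ∈ₛ S → Adjacent G u v →
                   ⟨ a u , d s ⟩ + c u * ⟨ d u , d s ⟩ ≡ ⟨ a v , d s ⟩ + c u * ⟨ d v , d s ⟩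
      inner-meet {u} {v} u∈S u~v = trans (sym (inner-line (a u) (c u) (d u)))
        (trans (sum-cong-≗ (λ j → cong (_* d s j) (meet u∈S u~v j))) (inner-line (a v) (c u) (d v)))

      -- The projected slope `⟨ d v , d s ⟩` attains `N`, the equality case of Cauchy-Schwarz on the
      -- sphere.
      d≡ds : ∀ v j → d v j ≡ d s j
      d≡ds v = sphere-≡ (d v) (d s) (norm≡N v) refl
        (slope-extremal inner-meet (λ v → sphere-≤ (d v) (d s) (norm≡N v) refl) refl
          (sum-cong-≗ (λ j → cong (_* d s j) (dt≡ds j)))
          (sum-cong-≗ (λ j → cong (_* d s j) (at≡as j))) v)

    directions-agree : ∀ u v j → d u j ≡ d v j
    directions-agree u v j = trans (d≡ds u j) (sym (d≡ds v j))

    -- Parallel lines that meet coincide.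
    origins-agree : ∀ u v j → a u j ≡ a v j
    origins-agree u v j = constant {λ v → a v j} (λ {u} {v} u∈S u~v → +-cancelʳ-≡ (c u * d u j) _ _
      (trans (meet u∈S u~v j) (cong (λ z → a v j + c u * z) (directions-agree v u j)))) u v

-- Protocols

-- One-round protocols: no message depends on what its sender has received, and
-- a vertex accepts exactly when it hears what it would hear if all inputs
-- were equal to its own.
module OneRound {n k} (G : Graph n) {I : Set} (from : I → Fin n) (size : I → ℕ)
                (message : ∀ i → Input k → Vec Bool (size i)) (items : List I) where

  broadcast : I → Broadcast n k
  broadcast i = record { sender = from i ; len = size i ; content = λ x _ → message i x }

  heard : (I → Input k) → Fin n → List I → Received
  heard x v is = map (λ i → toList (message i (x i))) (filterᵇ (λ i → adj G (from i) v) is)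

  _≟ʳ_ : (r r′ : Received) → Dec (r ≡ r′)
  _≟ʳ_ = ≡-dec (≡-dec _≟ᵇ_)

  protocol : Protocol n k
  protocol = record
    { broadcasts = map broadcast items
    ; accept     = λ v y r → does (r ≟ʳ heard (λ _ → y) v items)
    }

  entry : (Fin n → Input k) → I → Fin n × List Bool
  entry x i = from i , toList (message i (x (from i)))

  run≡ : ∀ x is tr → run G x (map broadcast is) tr ≡ tr ++ map (entry x) is
  run≡ x []       tr = sym (++-identityʳ tr)
  run≡ x (i ∷ is) tr = trans (run≡ x is (tr ++ [ entry x i ])) (++-assoc tr _ _)

  view-entries : ∀ x v is → view G v (map (entry x) is) ≡ heard (x ∘ from) v is
  view-entries x v [] = refl
  view-entries x v (i ∷ is) with adj G (from i) v
  ... | true  = cong (_ ∷_) (view-entries x v is)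
  ... | false = view-entries x v is

  view≡ : ∀ x v → view G v (run G x (map broadcast items) []) ≡ heard (x ∘ from) v items
  view≡ x v = trans (cong (view G v) (run≡ x items [])) (view-entries x v items)

  heard-cong : ∀ {x y} v is → (∀ i → x i ≡ y i) → heard x v is ≡ heard y v is
  heard-cong v [] x≗y = refl
  heard-cong v (i ∷ is) x≗y with adj G (from i) v
  ... | true  = cong₂ (λ z → toList (message i z) ∷_) (x≗y i) (heard-cong v is x≗y)
  ... | false = heard-cong v is x≗y

  -- Both lists are filtered by the same test, which ignores the inputs, so their entries correspond
  -- item by item.
  heard-injective : ∀ {x y} v is → heard x v is ≡ heard y v is →
                    ∀ {i} → i ∈ is → adj G (from i) v ≡ true → message i (x i) ≡ message i (y i)
  heard-injective v (i ∷ is) eq i∈ e with adj G (from i) v in ei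
  heard-injective v (i ∷ is) eq (here refl) e | true  = message-injective (∷-injectiveˡ eq)
    where
    message-injective : ∀ {m} {xs ys : Vec Bool m} → toList xs ≡ toList ys → xs ≡ ys
    message-injective {xs = xs} {ys} p = trans (sym (cast-is-id refl xs)) (toList-injective refl xs ys p)
  heard-injective v (i ∷ is) eq (there i∈) e  | true  = heard-injective v is (∷-injectiveʳ eq) i∈ e
  heard-injective v (i ∷ is) eq (here refl) e | false = contradiction (trans (sym e) ei) λ ()
  heard-injective v (i ∷ is) eq (there i∈) e  | false = heard-injective v is eq i∈ e

  -- The information gained when no vertex rejects; `solves` reduces correctness to deducing
  -- equality of all inputs from it.
  Agree : (Fin n → Input k) → Set
  Agree x = ∀ i v → i ∈ items → adj G (from i) v ≡ true → message i (x (from i)) ≡ message i (x v)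

  solves : (∀ x → Agree x → ∀ u v → x u ≡ x v) → SolvesEquality G protocol
  solves determined = complete , sound
    where
    complete : ∀ x → (∀ u v → x u ≡ x v) → ∀ v → Accepts G protocol x v
    complete x x≡ v = dec-true (_ ≟ʳ _) (trans (view≡ x v) (heard-cong v items (λ i → x≡ (from i) v)))

    sound : ∀ x → (∃ λ u → ∃ λ v → x u ≢ x v) → ∃ λ w → Rejects G protocol x w
    sound x (u , v , xu≢xv)
      -- Rejection is decidable: either a rejecting vertex is found, or every vertex has heard what
      -- it expects.
      with any? (λ w → accept protocol w (x w) (view G w (run G x (broadcasts protocol) [])) ≟ᵇ false)
    ... | yes rejecting = rejecting
    ... | no none = contradiction (determined x agree u v) xu≢xv
      where
      consistent : ∀ w → heard (x ∘ from) w items ≡ heard (λ _ → x w) w items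
      consistent w with view G w (run G x (map broadcast items) []) ≟ʳ heard (λ _ → x w) w items in eq
      ... | yes p = trans (sym (view≡ x w)) p
      ... | no _  = contradiction (w , cong does eq) none
      agree : Agree x
      agree _ w i∈ e = heard-injective w items (consistent w) i∈ e

-- Binary encoding of numbers and cutting of inputs

bits : (L : ℕ) → ℕ → Vec Bool L
bits zero    x = []
bits (suc L) x = (x % 2 ≡ᵇ 1) ∷ bits L (x / 2)

bits-injective : ∀ L {x y} → x < 2 ^ L → y < 2 ^ L → bits L x ≡ bits L y → x ≡ y
bits-injective zero    {zero} {zero} _ _ _ = refl
bits-injective zero    {suc _} (s≤s ()) _ _
bits-injective zero    {zero} {suc _} _ (s≤s ()) _
bits-injective (suc L) {x} {y} x< y< eq with ∷-injective eq
... | low , high = begin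
  x                   ≡⟨ m≡m%n+[m/n]*n x 2 ⟩
  x % 2 + x / 2 * 2   ≡⟨ cong₂ (λ l h → l + h * 2) (lastBit (m%n<n x 2) (m%n<n y 2) low)
                           (bits-injective L (half x<) (half y<) high) ⟩
  y % 2 + y / 2 * 2   ≡⟨ m≡m%n+[m/n]*n y 2 ⟨
  y                   ∎
  where
  open ≡-Reasoning
  half : ∀ {x} → x < 2 ^ suc L → x / 2 < 2 ^ L
  half x< = m<n*o⇒m/o<n (<-≤-trans x< (≤-reflexive (*-comm 2 (2 ^ L))))
  lastBit : ∀ {i j} → i < 2 → j < 2 → (i ≡ᵇ 1) ≡ (j ≡ᵇ 1) → i ≡ j
  lastBit {zero}        {zero}        _ _ _  = refl
  lastBit {zero}        {suc zero}    _ _ ()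
  lastBit {suc zero}    {zero}        _ _ ()
  lastBit {suc zero}    {suc zero}    _ _ _  = refl
  lastBit {suc (suc _)} (s≤s (s≤s ())) _ _
  lastBit {_} {suc (suc _)} _ (s≤s (s≤s ())) _

n<2^n : ∀ n → n < 2 ^ n
n<2^n zero    = s≤s z≤n
n<2^n (suc n) = begin-strict
  suc n               ≤⟨ n<2^n n ⟩
  2 ^ n               <⟨ m<n+m (2 ^ n) (m^n>0 2 n) ⟩
  2 ^ n + 2 ^ n       ≡⟨ cong (2 ^ n +_) (+-identityʳ (2 ^ n)) ⟨
  2 ^ suc n           ∎
  where open ≤-Reasoning

∑≤ : ∀ {m M} (f : Fin m → ℕ) → (∀ j → f j ≤ M) → ∑ f ≤ m * M
∑≤ {zero}  f f≤ = z≤n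
∑≤ {suc m} f f≤ = +-mono-≤ (f≤ zero) (∑≤ (f ∘ suc) (f≤ ∘ suc))

funToFin-injective : ∀ {m n} {f g : Fin m → Fin n} → funToFin f ≡ funToFin g → ∀ i → f i ≡ g i
funToFin-injective {f = f} {g} eq i = trans (sym (finToFun-funToFin f i))
  (trans (cong (λ z → finToFun z i) eq) (finToFun-funToFin g i))

padRight-injective : ∀ {a} {A : Set a} {m n} (m≤n : m ≤ n) (z : A) {xs ys : Vec A m} →
                     padRight m≤n z xs ≡ padRight m≤n z ys → xs ≡ ys
padRight-injective z≤n       z {[]}     {[]}     _  = refl
padRight-injective (s≤s m≤n) z {x ∷ xs} {y ∷ ys} eq with ∷-injective eq
... | refl , eq′ = cong (x ∷_) (padRight-injective m≤n z eq′)

lookup-extensional : ∀ {a} {A : Set a} {n} {xs ys : Vec A n} → (∀ i → lookup xs i ≡ lookup ys i) → xs ≡ ys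
lookup-extensional {xs = xs} {ys} eq =
  trans (sym (tabulate∘lookup xs)) (trans (tabulate-cong eq) (tabulate∘lookup ys))

-- An input of at most 2 s² bits is cut into 2 s blocks of s bits, which are read
-- as two vectors with s entries below 2 ^ s.
module Blocks {k s} (fits : k ≤ (s + s) * s) where

  digit : Bool → Fin 2
  digit false = zero
  digit true  = suc zero

  digit-injective : ∀ {b b′} → digit b ≡ digit b′ → b ≡ b′
  digit-injective {false} {false} _ = refl
  digit-injective {true}  {true}  _ = refl

  -- `combine p i` addresses bit `i` of block `p`. The padding by `false` is the same for all
  -- inputs, so it loses no information.
  block : Input k → Fin (s + s) → Fin (2 ^ s)
  block x p = funToFin (λ i → digit (lookup (padRight fits false x) (combine p i)))

  origin direction : Input k → Fin s → ℕ
  origin    x j = toℕ (block x (j ↑ˡ s))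
  direction x j = toℕ (block x (s ↑ʳ j))

  block-injective : ∀ {x y} → (∀ p → block x p ≡ block y p) → x ≡ y
  block-injective {x} {y} eq = padRight-injective fits false (lookup-extensional same)
    where
    same : ∀ q → lookup (padRight fits false x) q ≡ lookup (padRight fits false y) q
    same q with combine-surjective {s + s} {s} q
    ... | p , i , refl = digit-injective (funToFin-injective (eq p) i)

  input-determined : ∀ {x y} → (∀ j → origin x j ≡ origin y j) →
                     (∀ j → direction x j ≡ direction y j) → x ≡ y
  input-determined {x} {y} o≡ d≡ = block-injective same
    where
    same : ∀ p → block x p ≡ block y p
    same p with splitAt s p | join-splitAt s s p
    ... | inj₁ j | refl = toℕ-injective (o≡ j)
    ... | inj₂ j | refl = toℕ-injective (d≡ j)

-- The line protocol and its cost

elements : ∀ {n} → Subset n → List (Fin n)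
elements []            = []
elements (inside  ∷ S) = zero ∷ map suc (elements S)
elements (outside ∷ S) = map suc (elements S)

length-elements : ∀ {n} (S : Subset n) → length (elements S) ≡ ∣ S ∣
length-elements []            = refl
length-elements (inside  ∷ S) = cong suc (trans (length-map suc (elements S)) (length-elements S))
length-elements (outside ∷ S) = trans (length-map suc (elements S)) (length-elements S)

∈-elements : ∀ {n} {S : Subset n} {u} → u ∈ₛ S → u ∈ elements S
∈-elements {S = inside  ∷ S} here       = here refl
∈-elements {S = inside  ∷ S} (there u∈) = there (∈-map⁺ suc (∈-elements u∈))
∈-elements {S = outside ∷ S} (there u∈) = ∈-map⁺ suc (∈-elements u∈)

sum-cartesianProduct : ∀ {a b} {A : Set a} {B : Set b} (f : B → ℕ) (xs : List A) (ys : List B) →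
                       sum (map (f ∘ proj₂) (cartesianProduct xs ys)) ≡ length xs * sum (map f ys)
sum-cartesianProduct f []       ys = refl
sum-cartesianProduct f (x ∷ xs) ys = begin
  sum (map (f ∘ proj₂) (map (x ,_) ys ++ cartesianProduct xs ys))
    ≡⟨ cong sum (map-++ (f ∘ proj₂) (map (x ,_) ys) _) ⟩
  sum (map (f ∘ proj₂) (map (x ,_) ys) ++ map (f ∘ proj₂) (cartesianProduct xs ys))
    ≡⟨ sum-++ (map (f ∘ proj₂) (map (x ,_) ys)) _ ⟩
  sum (map (f ∘ proj₂) (map (x ,_) ys)) + sum (map (f ∘ proj₂) (cartesianProduct xs ys))
    ≡⟨ cong₂ _+_ (cong sum (sym (map-∘ ys))) (sum-cartesianProduct f xs ys) ⟩
  sum (map f ys) + length xs * sum (map f ys) ∎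
  where open ≡-Reasoning

sum-tabulate-const : ∀ m w → sum (tabulate {n = m} (λ _ → w)) ≡ m * w
sum-tabulate-const zero    w = refl
sum-tabulate-const (suc m) w = cong (w +_) (sum-tabulate-const m w)

module LineProtocol {n k s} (G : Graph n) (S : Subset n) (c : Fin n → ℕ) (bound : ℕ)
                    (c<bound : ∀ v → c v < bound) (fits : k ≤ (s + s) * s) where

  open Blocks {k} {s} fits

  Item : Set
  Item = Fin n × Fin (suc s)

  -- The squared norm is a sum of `s` squares below `2 ^ (s + s)`, and a coordinate of a point is
  -- below `bound * 2 ^ s`. Each sender thus spends `s * s` bits plus terms linear in `s`.
  width : Fin (suc s) → ℕ
  width zero    = s + (s + s)
  width (suc _) = s + bound

  -- The number `c u` belongs to the item, so a receiver can evaluate its own line at the number of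
  -- the sender.
  value : Item → Input k → ℕ
  value (u , zero)  x = ⟨ direction x , direction x ⟩
  value (u , suc j) x = origin x j + c u * direction x j

  value< : ∀ i x → value i x < 2 ^ width (proj₂ i)
  value< (u , zero) x = begin-strict
    ⟨ direction x , direction x ⟩
      ≤⟨ ∑≤ _ (λ j → *-mono-≤ (<⇒≤ (toℕ<n (block x (s ↑ʳ j)))) (<⇒≤ (toℕ<n (block x (s ↑ʳ j))))) ⟩
    s * (2 ^ s * 2 ^ s)       ≡⟨ cong (s *_) (^-distribˡ-+-* 2 s s) ⟨
    s * 2 ^ (s + s)           <⟨ *-monoˡ-< (2 ^ (s + s)) {{m^n≢0 2 (s + s)}} (n<2^n s) ⟩
    2 ^ s * 2 ^ (s + s)       ≡⟨ ^-distribˡ-+-* 2 s (s + s) ⟨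
    2 ^ (s + (s + s))         ∎
    where open ≤-Reasoning
  value< (u , suc j) x = begin-strict
    origin x j + c u * direction x j
      <⟨ +-mono-<-≤ (toℕ<n (block x (j ↑ˡ s))) (*-monoʳ-≤ (c u) (<⇒≤ (toℕ<n (block x (s ↑ʳ j))))) ⟩
    suc (c u) * 2 ^ s         ≤⟨ *-monoˡ-≤ (2 ^ s) (≤-trans (c<bound u) (<⇒≤ (n<2^n bound))) ⟩
    2 ^ bound * 2 ^ s         ≡⟨ *-comm (2 ^ bound) (2 ^ s) ⟩
    2 ^ s * 2 ^ bound         ≡⟨ ^-distribˡ-+-* 2 s bound ⟨
    2 ^ (s + bound)           ∎
    where open ≤-Reasoning

  open OneRound G {Item} proj₁ (width ∘ proj₂) (λ i x → bits (width (proj₂ i)) (value i x))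
    (cartesianProduct (elements S) (allFin (suc s))) public

  cost≡ : cost protocol ≡ ∣ S ∣ * (s + (s + s) + s * (s + bound))
  cost≡ = begin
    sum (map len (map broadcast items))
      ≡⟨ cong sum (map-∘ items) ⟨
    sum (map (width ∘ proj₂) items)
      ≡⟨ sum-cartesianProduct width (elements S) (allFin (suc s)) ⟩
    length (elements S) * (s + (s + s) + sum (map width (tabulate suc)))
      ≡⟨ cong₂ (λ l w → l * (s + (s + s) + w)) (length-elements S)
           (trans (cong sum (map-tabulate suc width)) (sum-tabulate-const s (s + bound))) ⟩
    ∣ S ∣ * (s + (s + s) + s * (s + bound)) ∎
    where
    open ≡-Reasoning
    items = cartesianProduct (elements S) (allFin (suc s))

  values-agree : ∀ {x} → Agree x →
    ∀ {u v} → u ∈ₛ S → adj G u v ≡ true → ∀ p → value (u , p) (x u) ≡ value (u , p) (x v)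
  values-agree {x} same {u} {v} u∈S u~v p =
    bits-injective (width p) (value< (u , p) (x u)) (value< (u , p) (x v))
      (same _ v (∈-cartesianProduct⁺ (∈-elements u∈S) (∈-allFin p)) u~v)

-- Asymptotics and the final family of protocols

half-sqrt : ∀ k → ∃ λ r → 2 * (r * r) ≤ k × k < 2 * (suc r * suc r)
half-sqrt zero = 0 , z≤n , s≤s z≤n
half-sqrt (suc k) with half-sqrt k
... | r , r≤ , k< with suc k <? 2 * (suc r * suc r)
...   | yes k+1< = r , m≤n⇒m≤1+n r≤ , k+1<
...   | no  k+1≮ = suc r , ≮⇒≥ k+1≮ ,
  ≤-<-trans k< (*-monoʳ-< 2 (*-mono-< (n<1+n (suc r)) (n<1+n (suc r))))

-- One sender's bits for blocks of length `suc r` number `r * r + (b + 5) * r + (b + 4)`; the lower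
-- terms are absorbed once `r` reaches `m * (2 * b + 9)`. Divided by `2 * m`, the right side is
-- `1/2 + 1/m` times `2 * (r * r)`, so `1/m` stands for the vanishing error.
cost-estimate : ∀ m b r → 1 ≤ m → m * (2 * b + 9) ≤ r →
  2 * m * (suc r + (suc r + suc r) + suc r * (suc r + b)) ≤ (m + 2) * (2 * (r * r))
cost-estimate m b r 1≤m T≤r = begin
  2 * m * (suc r + (suc r + suc r) + suc r * (suc r + b))
    ≡⟨ expand m b r ⟩
  2 * m * (r * r) + 2 * m * ((b + 5) * r + (b + 4) * 1)
    ≤⟨ +-monoʳ-≤ (2 * m * (r * r)) (*-monoʳ-≤ (2 * m) (+-monoʳ-≤ ((b + 5) * r) (*-monoʳ-≤ (b + 4) 1≤r))) ⟩
  2 * m * (r * r) + 2 * m * ((b + 5) * r + (b + 4) * r)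
    ≡⟨ collect m b r ⟩
  2 * m * (r * r) + 2 * (m * (2 * b + 9) * r)
    -- Relaxing `2` to `4` is affordable: the `2` in `m + 2` provides exactly `4 * (r * r)`.
    ≤⟨ +-monoʳ-≤ (2 * m * (r * r)) (*-mono-≤ (s≤s (s≤s (z≤n {2}))) (*-monoˡ-≤ r T≤r)) ⟩
  2 * m * (r * r) + 4 * (r * r)
    ≡⟨ factor m r ⟩
  (m + 2) * (2 * (r * r)) ∎
  where
  open ≤-Reasoning
  1≤r : 1 ≤ r
  1≤r = ≤-trans (*-mono-≤ 1≤m (≤-trans (s≤s z≤n) (m≤n+m 9 (2 * b)))) T≤r
  expand : ∀ m b r → 2 * m * (suc r + (suc r + suc r) + suc r * (suc r + b)) ≡
                     2 * m * (r * r) + 2 * m * ((b + 5) * r + (b + 4) * 1)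
  expand = solve-∀
  collect : ∀ m b r → 2 * m * (r * r) + 2 * m * ((b + 5) * r + (b + 4) * r) ≡
                      2 * m * (r * r) + 2 * (m * (2 * b + 9) * r)
  collect = solve-∀
  factor : ∀ m r → 2 * m * (r * r) + 4 * (r * r) ≡ (m + 2) * (2 * (r * r))
  factor = solve-∀

theorem1p3 : ∀ {n} (G : Graph n) → TwoConnected G → ∀ t → IsTvc G t →
    ∃ λ (Π : (k : ℕ) → Protocol n k) →
    (∀ k → 1 ≤ k → SolvesEquality G (Π k)) ×
    (∀ m → 1 ≤ m → ∃ λ K → ∀ k → K ≤ k →
    2 * m * cost (Π k) ≤ (m + 2) * k * t)
-- Total domination at an arbitrary vertex gives `s` in `S`, and at `s` it gives a neighbour `t` in
-- `S`.
theorem1p3 {suc n} G 2-connected _ ((S , tvc , refl) , _) with proj₂ tvc zero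
... | s , _ , s∈S with proj₂ tvc s
... | t , s~t , t∈S = Π , correct , cheap
  where
  numbering : STNumbering G s t
  numbering = st-numbering G 2-connected s~t
  open STNumbering numbering

  -- The integer part of the square root of `k / 2`. Blocks one bit longer than this hold all `k`
  -- bits, while twice its square is at most `k`, which bounds the cost.
  root : ℕ → ℕ
  root k = proj₁ (half-sqrt k)

  fits : ∀ k → k ≤ (suc (root k) + suc (root k)) * suc (root k)
  fits k = ≤-trans (<⇒≤ (proj₂ (proj₂ (half-sqrt k)))) (≤-reflexive (double (suc (root k))))
    where
    double : ∀ s → 2 * (s * s) ≡ (s + s) * s
    double = solve-∀

  module P (k : ℕ) = LineProtocol {s = suc (root k)} G S c bound c<bound (fits k)

  Π : ∀ k → Protocol (suc n) k
  Π k = P.protocol k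

  correct : ∀ k → 1 ≤ k → SolvesEquality G (Π k)
  correct k _ = P.solves k determined
    where
    open Blocks {s = suc (root k)} (fits k)
    determined : ∀ x → P.Agree k x → ∀ u v → x u ≡ x v
    determined x same u v = input-determined
      (origins-agree connected tvc s∈S t∈S s~t numbering {d = direction ∘ x} norm meet u v)
      (directions-agree connected tvc s∈S t∈S s~t numbering {a = origin ∘ x} norm meet u v)
      where
      connected = proj₁ (proj₂ 2-connected)
      norm : ∀ {u v} → u ∈ₛ S → adj G u v ≡ true →
             ⟨ direction (x u) , direction (x u) ⟩ ≡ ⟨ direction (x v) , direction (x v) ⟩
      norm u∈S u~v = P.values-agree k same u∈S u~v zero
      meet : ∀ {u v} → u ∈ₛ S → adj G u v ≡ true → ∀ j →
             origin (x u) j + c u * direction (x u) j ≡ origin (x v) j + c u * direction (x v) j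
      meet u∈S u~v j = P.values-agree k same u∈S u~v (suc j)

  cheap : ∀ m → 1 ≤ m → ∃ λ K → ∀ k → K ≤ k → 2 * m * cost (Π k) ≤ (m + 2) * k * ∣ S ∣
  -- If `root k` were below `T`, then `k` would be below `2 * (T * T)`; this threshold therefore
  -- ensures the `T ≤ root k` that `cost-estimate` asks for.
  cheap m 1≤m = 2 * (T * T) , λ k K≤k →
    let r = root k ; w = suc r + (suc r + suc r) + suc r * (suc r + bound) in begin
    2 * m * cost (Π k)                ≡⟨ cong (2 * m *_) (P.cost≡ k) ⟩
    2 * m * (∣ S ∣ * w)               ≡⟨ swap (2 * m) ∣ S ∣ w ⟩
    2 * m * w * ∣ S ∣                 ≤⟨ *-monoˡ-≤ ∣ S ∣ (cost-estimate m bound r 1≤m (T≤root K≤k)) ⟩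
    (m + 2) * (2 * (r * r)) * ∣ S ∣   ≤⟨ *-monoˡ-≤ ∣ S ∣ (*-monoʳ-≤ (m + 2) (proj₁ (proj₂ (half-sqrt k)))) ⟩
    (m + 2) * k * ∣ S ∣               ∎
    where
    open ≤-Reasoning
    T : ℕ
    T = m * (2 * bound + 9)
    swap : ∀ x y z → x * (y * z) ≡ x * z * y
    swap = solve-∀
    T≤root : ∀ {k} → 2 * (T * T) ≤ k → T ≤ root k
    T≤root {k} K≤k = ≮⇒≥ λ r<T → <⇒≱ (proj₂ (proj₂ (half-sqrt k)))
      (≤-trans (*-monoʳ-≤ 2 (*-mono-≤ r<T r<T)) K≤k)
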